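{- Let $\mathbb{K}$ be an associative ring with unity (not necessarily commutative). Let $P$ be any finite poset. Let $f\in\mathbb{K}^{\widehat{P}}$ be a $\mathbb{K}$-labeling of $P$ such that $Rf\neq\bot$ and $f(0)=f(1)=1$, where $R$ is birational rowmotion of $P$. Assume that the inverses $\big((Rf)(v)\big)^{ -1}$ appearing on the left-hand side below are well-defined. Then $$\sum_{\substack{u,v\in\widehat{P};\\ u\lessdot v}}(Rf)(u)\cdot\big((Rf)(v)\big)^{ -1}=\sum_{\substack{u,v\in\widehat{P};\\ u\lessdot v}}f(u)\cdot\big(f(v)\big)^{ -1}.$$
   Context: $\mathbb{K}$ is a fixed associative ring with unity, not necessarily commutative. An element is invertible if it has a two-sided inverse $x^{ -1}$. An equality in which an inverse $x^{ -1}$ appears is understood to include the assertion that $x$ is invertible (unless this is assumed). Extended poset. For a finite poset $P$, $\widehat{P}$ is the poset on the disjoint union $P\sqcup\{0,1\}$ in which $u\le v$ iff ($u,v\in P$ and $u\le v$ in $P$) or $u=0$ or $v=1$. Write $u\lessdot v$ (equivalently $v\gtrdot u$) if $u<v$ and no $w$ satisfies $u<w<v$ (in $\widehat{P}$). Labelings and partial maps. A $\mathbb{K}$-labeling of $P$ is a map $f:\widehat{P}\to\mathbb{K}$; the set of these is $\mathbb{K}^{\widehat{P}}$. A partial map $F:X\dashrightarrow Y$ is a map $X\to Y\sqcup\{\bot\}$, where $\bot$ means "undefined"; it is extended by $F(\bot)=\bot$, and partial maps are composed accordingly. Toggles. For $v\in P$, the toggle $T_v:\mathbb{K}^{\widehat{P}}\dashrightarrow\mathbb{K}^{\widehat{P}}$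 is defined by $(T_vf)(w)=f(w)$ for $w\ne v$ and $$(T_vf)(v)=\Big(\sum_{u\in\widehat{P},\,u\lessdot v}f(u)\Big)\cdot f(v)^{ -1}\cdot\Big(\sum_{u\in\widehat{P},\,u\gtrdot v}f(u)^{ -1}\Big)^{ -1};$$ if any inverse in this formula does not exist, then $T_vf:=\bot$. Birational rowmotion. $R:=T_{v_1}\circ T_{v_2}\circ\cdots\circ T_{v_m}:\mathbb{K}^{\widehat{P}}\dashrightarrow\mathbb{K}^{\widehat{P}}$, where $(v_1,\ldots,v_m)$ is any linear extension of $P$ (a list of all elements of $P$, each exactly once, such that $v_i<v_j$ implies $i<j$); so the toggles at larger elements are applied first. This partial map does not depend on the choice of linear extension. -}

module Defs where

open import Algebra.Bundles using (Ring)
import Algebra.Definitions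
open import Data.Bool.Base using (if_then_else_)
open import Data.Fin.Base as Fin using (Fin)
open import Data.List.Base using (List; []; _∷_; map; filter; foldr; lookup; cartesianProduct)
open import Data.List.Membership.Propositional using (_∈_; lose)
open import Data.List.Membership.Propositional.Properties using (∈-map⁺)
open import Data.List.Relation.Unary.Any as Any using (here; there)
open import Data.List.Relation.Unary.Unique.Propositional using (Unique)
open import Data.Product.Base using (Σ-syntax; ∃; ∃-syntax; _×_; _,_; proj₁; uncurry)
open import Data.Unit.Polymorphic.Base using (⊤)
open import Level using (Level; _⊔_; suc)
open import Relation.Binary.Core using (Rel)
open import Relation.Binary.Definitions using (Decidable)
open import Relation.Binary.PropositionalEquality using (_≡_; refl)
open import Relation.Binary.Structures using (IsDecPartialOrder)
import Relation.Binary.Construct.Add.Extrema.NonStrict as AddExtrema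
import Relation.Binary.Construct.NonStrictToStrict as NonStrictToStrict
open import Relation.Nullary.Construct.Add.Extrema using (_±; ⊥±; ⊤±; [_])
open import Relation.Nullary.Decidable using (does; map′; ¬?; _×-dec_)
open import Relation.Nullary.Negation using (¬_)

private
  variable
    a b d : Level
    A : Set a
    B : Set b

-- Invertibility in an arbitrary ring is not decidable, so the value ⊥
-- ("undefined") cannot be a tag to branch on.  An element of A ⊔ {⊥} is instead
-- given by the proposition that it is not ⊥ and by its value when this holds;
-- a partial map A ⇢ B is a function A → Partial d B.
record Partial (d : Level) (A : Set a) : Set (a ⊔ suc d) where
  field
    Defined : Set d
    value   : Defined → A

open Partial public

pure : A → Partial d A
pure x .Defined = ⊤
pure x .value _ = x

infixl 1 _>>=_

_>>=_ : Partial d A → (A → Partial d B) → Partial d B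
(p >>= F) .Defined       = Σ[ x ∈ Defined p ] Defined (F (value p x))
(p >>= F) .value (x , y) = value (F (value p x)) y

record FinitePoset (p ℓ : Level) : Set (suc (p ⊔ ℓ)) where
  infix 4 _≤_
  field
    Carrier           : Set p
    _≤_               : Rel Carrier ℓ
    isDecPartialOrder : IsDecPartialOrder _≡_ _≤_
    elements          : List Carrier
    unique            : Unique elements
    complete          : ∀ v → v ∈ elements

  open NonStrictToStrict _≡_ _≤_ public using (_<_)

  -- P̂, with 0 = ⊥± and 1 = ⊤±.
  P̂ : Set p
  P̂ = Carrier ±

  open AddExtrema _≤_ public using (_≤±_)

  open IsDecPartialOrder (AddExtrema.≤±-isDecPartialOrder-≡ _≤_ isDecPartialOrder)
    public using () renaming (_≟_ to _≟±_; _≤?_ to _≤±?_)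

  open NonStrictToStrict _≡_ _≤±_ public
    using () renaming (_<_ to _<±_; <-decidable to <±-decidable)

  infix 4 _<±?_ _⋖_ _⋖?_

  _<±?_ : Decidable _<±_
  _<±?_ = <±-decidable _≟±_ _≤±?_

  _⋖_ : Rel P̂ (p ⊔ ℓ)
  u ⋖ v = u <± v × ¬ (∃[ w ] (u <± w × w <± v))

  elements± : List P̂
  elements± = ⊥± ∷ ⊤± ∷ map [_] elements

  complete± : ∀ v → v ∈ elements±
  complete± ⊥±    = here refl
  complete± ⊤±    = there (here refl)
  complete± [ v ] = there (there (∈-map⁺ [_] (complete v)))

  _⋖?_ : Decidable _⋖_
  u ⋖? v = (u <±? v) ×-dec ¬? (map′ Any.satisfied (λ (w , u<w<v) → lose (complete± w) u<w<v)
                                (Any.any? (λ w → (u <±? w) ×-dec (w <±? v)) elements±))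

  lowerCovers upperCovers : P̂ → List P̂
  lowerCovers v = filter (λ u → u ⋖? v) elements±
  upperCovers v = filter (λ u → v ⋖? u) elements±

  coverPairs : List (P̂ × P̂)
  coverPairs = filter (uncurry _⋖?_) (cartesianProduct elements± elements±)

  record IsLinearExtension (vs : List Carrier) : Set (p ⊔ ℓ) where
    field
      noRepeats   : Unique vs
      allElements : ∀ v → v ∈ vs
      increasing  : ∀ i j → lookup vs i < lookup vs j → i Fin.< j

module Rowmotion {c ℓ p ℓ′} (K : Ring c ℓ) (P : FinitePoset p ℓ′) where

  open Ring K using (_≈_; _+_; _*_; 0#; 1#) renaming (Carrier to 𝕂)
  open Algebra.Definitions _≈_ using (Invertible)
  open FinitePoset P using (P̂; _≟±_; lowerCovers; upperCovers; coverPairs)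

  Partialᴷ : Set a → Set (a ⊔ suc (c ⊔ ℓ))
  Partialᴷ = Partial (c ⊔ ℓ)

  infix 8 _⁻¹

  _⁻¹ : 𝕂 → Partialᴷ 𝕂
  (x ⁻¹) .Defined = Invertible 1# _*_ x
  (x ⁻¹) .value   = proj₁

  ∑ : List A → (A → 𝕂) → 𝕂
  ∑ xs t = foldr (λ x s → t x + s) 0# xs

  -- Defined exactly when every summand is.
  ∑ᵖ : List A → (A → Partialᴷ 𝕂) → Partialᴷ 𝕂
  ∑ᵖ []       t = pure 0#
  ∑ᵖ (x ∷ xs) t = do
    y ← t x
    s ← ∑ᵖ xs t
    pure (y + s)

  Labeling : Set (c ⊔ p)
  Labeling = P̂ → 𝕂

  update : P̂ → 𝕂 → Labeling → Labeling
  update v x f w = if does (w ≟± v) then x else f w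

  toggle : FinitePoset.Carrier P → Labeling → Partialᴷ Labeling
  toggle v f = do
    y ← f [ v ] ⁻¹
    s ← ∑ᵖ (upperCovers [ v ]) (λ u → f u ⁻¹)
    z ← s ⁻¹
    pure (update [ v ] (∑ (lowerCovers [ v ]) f * y * z) f)

  -- T_{v₁} ∘ ⋯ ∘ T_{vₘ}: the last toggle of the list acts first.
  rowmotion : List (FinitePoset.Carrier P) → Labeling → Partialᴷ Labeling
  rowmotion []       f = pure f
  rowmotion (v ∷ vs) f = rowmotion vs f >>= toggle v

  coverSum : Labeling → Partialᴷ 𝕂
  coverSum f = ∑ᵖ coverPairs λ (u , v) → do
    y ← f v ⁻¹
    pure (f u * y)

{-# OPTIONS --safe #-}

-- Write g = Rf.  Toggling v ∈ P uses the labels of f below v and those of g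
-- above v, so
--   g(v) · Σ_{u ⋗ v} g(u)⁻¹ = (Σ_{u ⋖ v} f(u)) · f(v)⁻¹.                  (*)
-- Summed over v ∈ P, (*) matches the two sides of the theorem except for the
-- terms with u = 0 on the left and those with v = 1 on the right.  These agree:
-- multiplying (*) by g(v)⁻¹ on the left and by f(v) on the right and summing
-- over v ∈ P gives Σ g(b)⁻¹ f(a) over the covers a ⋖ b with a ∈ P on one side and
-- over those with b ∈ P on the other, so the sums over the remaining covers are
-- equal: Σ_{b ⋗ 0} g(b)⁻¹ f(0) = Σ_{a ⋖ 1} g(1)⁻¹ f(a).
module Submission where

open import Defs
open import Algebra.Bundles using (Ring)
import Algebra.Definitions
import Algebra.Properties.AbelianGroup
import Algebra.Properties.CommutativeSemigroup
import Algebra.Properties.Monoid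
open import Data.Bool.Base using (Bool; true; false; if_then_else_)
open import Data.List.Base using (List; []; _∷_; _++_; map; filter; cartesianProduct; lookup)
open import Data.List.Membership.Propositional using (_∈_)
open import Data.List.Membership.Propositional.Properties
  using (∈-filter⁺; ∈-filter⁻; ∈-cartesianProduct⁺)
open import Data.List.Properties using (filter-none; foldr-map)
open import Data.List.Relation.Unary.All as All using (All; []; _∷_)
open import Data.List.Relation.Unary.AllPairs using (AllPairs; []; _∷_)
open import Data.List.Relation.Unary.Any using (here; there; index)
open import Data.List.Relation.Unary.Any.Properties using (lookup-index)
open import Data.List.Relation.Unary.Unique.Propositional using (Unique)
open import Data.Product.Base using (Σ-syntax; ∃-syntax; _×_; _,_; proj₁; proj₂; uncurry)
open import Data.Fin.Base as Fin using ()
open import Data.Nat.Base using (s<s⁻¹)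
open import Function.Base using (_∘_)
open import Level using (Level)
open import Relation.Binary.PropositionalEquality
  using (_≡_; _≢_; refl; cong; subst) renaming (trans to ≡-trans)
import Relation.Binary.Construct.Add.Extrema.NonStrict as AddExtrema
import Relation.Binary.Construct.NonStrictToStrict as NonStrictToStrict
import Relation.Binary.Reasoning.Setoid
open import Relation.Binary.Structures using (IsDecPartialOrder)
open import Relation.Nullary.Construct.Add.Extrema using (⊥±; ⊤±; [_])
open import Relation.Nullary.Decidable using (Dec; does; yes; no)
open import Relation.Nullary.Negation using (¬_; contradiction)
import Relation.Unary as Unary

private
  variable
    a b r : Level
    A : Set a
    B : Set b

-- Covers in the extended poset and the order of a linear extension.

module Covers {p ℓ} (P : FinitePoset p ℓ) where

  open FinitePoset P
  open IsDecPartialOrder (AddExtrema.≤±-isDecPartialOrder-≡ _≤_ isDecPartialOrder)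
    using () renaming (isPartialOrder to ≤±-isPartialOrder)
  open NonStrictToStrict _≡_ _≤±_ using (<-trans)

  ⋖⇒≤ : ∀ {v w} → [ v ] ⋖ [ w ] → v ≤ w
  ⋖⇒≤ ((AddExtrema.[ v≤w ] , _) , _) = v≤w

  ⋖⊥±-absurd : ∀ {u} → ¬ (u ⋖ ⊥±)
  ⋖⊥±-absurd ((AddExtrema.⊥±≤⊥± , ≢) , _) = ≢ refl

  ⊤±⋖-absurd : ∀ {u} → ¬ (⊤± ⋖ u)
  ⊤±⋖-absurd ((AddExtrema.⊤±≤⊤± , ≢) , _) = ≢ refl

  lowerCovers-⊥± : lowerCovers ⊥± ≡ []
  lowerCovers-⊥± = filter-none (_⋖? ⊥±) {elements±} (All.tabulate λ _ → ⋖⊥±-absurd)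

  upperCovers-⊤± : upperCovers ⊤± ≡ []
  upperCovers-⊤± = filter-none (⊤± ⋖?_) {elements±} (All.tabulate λ _ → ⊤±⋖-absurd)

  v≢⊥±⇒⊥±<v : ∀ {v} → v ≢ ⊥± → ⊥± <± v
  v≢⊥±⇒⊥±<v v≢⊥± = (AddExtrema.⊥±≤ _) _ , v≢⊥± ∘ λ { refl → refl }

  -- Induction on the list, starting from 0: the candidate is replaced by `x` whenever `x` lies
  -- strictly between it and `v`. Raising the candidate shrinks the interval, so entries already
  -- excluded stay excluded.
  maximal-below : ∀ {v} → ⊥± <± v → ∀ xs →
                  ∃[ u ] (u <± v × All (λ x → ¬ (u <± x × x <± v)) xs)
  maximal-below 0<v [] = ⊥± , 0<v , []
  maximal-below {v} 0<v (x ∷ xs) with maximal-below 0<v xs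
  ... | u , u<v , none with u <±? x | x <±? v
  ...   | yes u<x | yes x<v = x , x<v , (λ ((_ , x≢x) , _) → x≢x refl) ∷
        All.map (λ ¬between (x<y , y<v) →
                   ¬between (<-trans ≤±-isPartialOrder u<x x<y , y<v)) none
  ...   | no  u≮x | _       = u , u<v , (u≮x ∘ proj₁) ∷ none
  ...   | yes _   | no x≮v  = u , u<v , (x≮v ∘ proj₂) ∷ none

  lower-cover : ∀ {v} → v ≢ ⊥± → ∃[ u ] u ⋖ v
  lower-cover v≢⊥± with maximal-below (v≢⊥±⇒⊥±<v v≢⊥±) elements±
  ... | u , u<v , none = u , u<v , λ (w , u<w<v) → All.lookup none (complete± w) u<w<v

  -- If `w` came after `v` with `w ≤ v`, then distinctness would give `w < v`, and `increasing`
  -- would put `w` first.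
  linearExtension-≰ : ∀ {vs} → IsLinearExtension vs → AllPairs (λ v w → ¬ w ≤ v) vs
  linearExtension-≰ ext = go noRepeats increasing
    where
    open IsLinearExtension ext
    -- The recursion drops `allElements`, which fails for the tail of the list.
    go : ∀ {vs} → Unique vs → (∀ i j → lookup vs i < lookup vs j → i Fin.< j) →
         AllPairs (λ v w → ¬ w ≤ v) vs
    go [] inc = []
    go {v ∷ vs} (v∉vs ∷ uniq) inc =
      All.tabulate (λ w∈vs w≤v →
        contradiction (inc (Fin.suc (index w∈vs)) Fin.zero
                         (subst (_< v) (lookup-index w∈vs)
                           (w≤v , λ { refl → All.lookup v∉vs w∈vs refl })))
                      λ ())
      ∷ go uniq (λ i j lt → s<s⁻¹ (inc (Fin.suc i) (Fin.suc j) lt))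

-- Finite sums over lists, total and partial.

module Sums {c ℓ p ℓ′} (K : Ring c ℓ) (P : FinitePoset p ℓ′) where

  open Ring K renaming (Carrier to 𝕂; refl to ≈-refl; sym to ≈-sym; trans to ≈-trans)
  open Rowmotion K P
  open Algebra.Properties.CommutativeSemigroup +-commutativeSemigroup using (interchange)
  open Relation.Binary.Reasoning.Setoid setoid

  ∑-cong : ∀ (xs : List A) {F G : A → 𝕂} → (∀ {x} → x ∈ xs → F x ≈ G x) → ∑ xs F ≈ ∑ xs G
  ∑-cong []       F≈G = ≈-refl
  ∑-cong (x ∷ xs) F≈G = +-cong (F≈G (here refl)) (∑-cong xs (F≈G ∘ there))

  ∑-zero : ∀ (xs : List A) → ∑ xs (λ _ → 0#) ≈ 0#
  ∑-zero []       = ≈-refl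
  ∑-zero (x ∷ xs) = ≈-trans (+-identityˡ _) (∑-zero xs)

  ∑-+ : ∀ (xs : List A) (F G : A → 𝕂) → ∑ xs (λ x → F x + G x) ≈ ∑ xs F + ∑ xs G
  ∑-+ []       F G = ≈-sym (+-identityˡ 0#)
  ∑-+ (x ∷ xs) F G = ≈-trans (+-congˡ (∑-+ xs F G)) (interchange _ _ _ _)

  *-distribˡ-∑ : ∀ k (xs : List A) (F : A → 𝕂) → k * ∑ xs F ≈ ∑ xs (λ x → k * F x)
  *-distribˡ-∑ k []       F = zeroʳ k
  *-distribˡ-∑ k (x ∷ xs) F = ≈-trans (distribˡ k _ _) (+-congˡ (*-distribˡ-∑ k xs F))

  *-distribʳ-∑ : ∀ k (xs : List A) (F : A → 𝕂) → ∑ xs F * k ≈ ∑ xs (λ x → F x * k)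
  *-distribʳ-∑ k []       F = zeroˡ k
  *-distribʳ-∑ k (x ∷ xs) F = ≈-trans (distribʳ k _ _) (+-congˡ (*-distribʳ-∑ k xs F))

  ∑-++ : ∀ (xs ys : List A) (F : A → 𝕂) → ∑ (xs ++ ys) F ≈ ∑ xs F + ∑ ys F
  ∑-++ []       ys F = ≈-sym (+-identityˡ _)
  ∑-++ (x ∷ xs) ys F = ≈-trans (+-congˡ (∑-++ xs ys F)) (≈-sym (+-assoc _ _ _))

  ∑-map : ∀ (h : A → B) xs (F : B → 𝕂) → ∑ (map h xs) F ≡ ∑ xs (F ∘ h)
  ∑-map h xs F = foldr-map (λ x s → F x + s) h 0# xs

  ∑-cartesianProduct : ∀ (xs : List A) (ys : List B) (F : A × B → 𝕂) →
                       ∑ (cartesianProduct xs ys) F ≈ ∑ xs (λ x → ∑ ys (λ y → F (x , y)))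
  ∑-cartesianProduct []       ys F = ≈-refl
  ∑-cartesianProduct (x ∷ xs) ys F = ≈-trans (∑-++ (map (x ,_) ys) _ F)
    (+-cong (reflexive (∑-map (x ,_) ys F)) (∑-cartesianProduct xs ys F))

  ∑-swap : ∀ (xs : List A) (ys : List B) (F : A → B → 𝕂) →
           ∑ xs (λ x → ∑ ys (F x)) ≈ ∑ ys (λ y → ∑ xs (λ x → F x y))
  ∑-swap []       ys F = ≈-sym (∑-zero ys)
  ∑-swap (x ∷ xs) ys F = ≈-trans (+-congˡ (∑-swap xs ys F)) (≈-sym (∑-+ ys (F x) _))

  infix 5 _when_

  -- Replaces a filter by zero terms, so that the ranges of a double sum become independent and can
  -- be exchanged.
  _when_ : 𝕂 → Bool → 𝕂
  k when β = if β then k else 0#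

  ∑-filter : {Q : Unary.Pred A r} (Q? : Unary.Decidable Q) (xs : List A) (F : A → 𝕂) →
             ∑ (filter Q? xs) F ≈ ∑ xs (λ x → F x when does (Q? x))
  ∑-filter Q? []       F = ≈-refl
  ∑-filter Q? (x ∷ xs) F with does (Q? x)
  ... | true  = +-congˡ (∑-filter Q? xs F)
  ... | false = ≈-trans (∑-filter Q? xs F) (≈-sym (+-identityˡ _))

  module _ {_~_ : A → B → Set r} (_~?_ : ∀ x y → Dec (x ~ y))
           (xs : List A) (ys : List B) where

    ∑-filter-cartesianProduct : (F : A → B → 𝕂) →
      ∑ (filter (uncurry _~?_) (cartesianProduct xs ys)) (uncurry F) ≈
      ∑ xs (λ x → ∑ (filter (x ~?_) ys) (F x))
    ∑-filter-cartesianProduct F = begin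
      ∑ (filter (uncurry _~?_) (cartesianProduct xs ys)) (uncurry F)
        ≈⟨ ∑-filter (uncurry _~?_) (cartesianProduct xs ys) (uncurry F) ⟩
      ∑ (cartesianProduct xs ys) (λ (x , y) → F x y when does (x ~? y))
        ≈⟨ ∑-cartesianProduct xs ys _ ⟩
      ∑ xs (λ x → ∑ ys (λ y → F x y when does (x ~? y)))
        ≈⟨ ∑-cong xs (λ {x} _ → ∑-filter (x ~?_) ys (F x)) ⟨
      ∑ xs (λ x → ∑ (filter (x ~?_) ys) (F x)) ∎

    ∑-filter-swap : (F : A → B → 𝕂) →
      ∑ xs (λ x → ∑ (filter (x ~?_) ys) (F x)) ≈
      ∑ ys (λ y → ∑ (filter (_~? y) xs) (λ x → F x y))
    ∑-filter-swap F = begin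
      ∑ xs (λ x → ∑ (filter (x ~?_) ys) (F x))
        ≈⟨ ∑-cong xs (λ {x} _ → ∑-filter (x ~?_) ys (F x)) ⟩
      ∑ xs (λ x → ∑ ys (λ y → F x y when does (x ~? y)))
        ≈⟨ ∑-swap xs ys _ ⟩
      ∑ ys (λ y → ∑ xs (λ x → F x y when does (x ~? y)))
        ≈⟨ ∑-cong ys (λ {y} _ → ∑-filter (_~? y) xs (λ x → F x y)) ⟨
      ∑ ys (λ y → ∑ (filter (_~? y) xs) (λ x → F x y)) ∎

  ∑ᵖ-defined : ∀ {xs : List A} {t : A → Partialᴷ 𝕂} →
               (∀ {x} → x ∈ xs → Defined (t x)) → Defined (∑ᵖ xs t)
  ∑ᵖ-defined {xs = []}     d = _
  ∑ᵖ-defined {xs = x ∷ xs} d = d (here refl) , ∑ᵖ-defined (d ∘ there) , _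

  ∑ᵖ-defined⁻ : ∀ {xs : List A} {t : A → Partialᴷ 𝕂} →
                Defined (∑ᵖ xs t) → ∀ {x} → x ∈ xs → Defined (t x)
  ∑ᵖ-defined⁻ (d , _)     (here refl)  = d
  ∑ᵖ-defined⁻ (_ , d , _) (there x∈xs) = ∑ᵖ-defined⁻ d x∈xs

  -- A value may depend on the definedness proof, so the summands are compared for every such proof.
  ∑ᵖ-value : ∀ (xs : List A) (t : A → Partialᴷ 𝕂) {F : A → 𝕂} →
             (∀ {x} → x ∈ xs → (d : Defined (t x)) → value (t x) d ≈ F x) →
             (d : Defined (∑ᵖ xs t)) → value (∑ᵖ xs t) d ≈ ∑ xs F
  ∑ᵖ-value []       t t≈F _           = ≈-refl
  ∑ᵖ-value (x ∷ xs) t t≈F (d , e , _) =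
    +-cong (t≈F (here refl) d) (∑ᵖ-value xs t (t≈F ∘ there) e)

-- Inverses, toggles and the equation satisfied by rowmotion.

module RowmotionProperties {c ℓ p ℓ′} (K : Ring c ℓ) (P : FinitePoset p ℓ′) where

  open Ring K renaming (Carrier to 𝕂; refl to ≈-refl; sym to ≈-sym; trans to ≈-trans)
  open Algebra.Definitions _≈_ using (Invertible)
  open Algebra.Properties.AbelianGroup +-abelianGroup using (∙-cancelʳ)
  open Algebra.Properties.Monoid *-monoid using (cancelˡ; cancelʳ; introʳ)
  open Relation.Binary.Reasoning.Setoid setoid
  open FinitePoset P
  open IsDecPartialOrder isDecPartialOrder using () renaming (refl to ≤-refl)
  open Rowmotion K P
  open Covers P
  open Sums K P

  infix 4 _InverseOf_

  _InverseOf_ : 𝕂 → 𝕂 → Set ℓ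
  y InverseOf x = y * x ≈ 1# × x * y ≈ 1#

  inverse-resp : ∀ {x x′ y} → x ≈ x′ → y InverseOf x → y InverseOf x′
  inverse-resp x≈x′ (yx , xy) =
    ≈-trans (*-congˡ (≈-sym x≈x′)) yx , ≈-trans (*-congʳ (≈-sym x≈x′)) xy

  -- Inverses are witnesses inside definedness proofs; this identifies those supplied by different
  -- proofs.
  inverse-unique : ∀ {x y y′} → y InverseOf x → y′ InverseOf x → y ≈ y′
  inverse-unique (yx , _) (_ , xy′) = ≈-trans (introʳ xy′ _) (cancelˡ yx _)

  ≈1#⇒inverse : ∀ {x} → x ≈ 1# → 1# InverseOf x
  ≈1#⇒inverse x≈1 = ≈-trans (*-identityˡ _) x≈1 , ≈-trans (*-identityʳ _) x≈1

  update-≡ : ∀ v x f → update v x f v ≡ x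
  update-≡ v x f with v ≟± v
  ... | yes _  = refl
  ... | no v≢v = contradiction refl v≢v

  update-≢ : ∀ {v w} x f → w ≢ v → update v x f w ≡ f w
  update-≢ {v} {w} x f w≢v with w ≟± v
  ... | yes w≡v = contradiction w≡v w≢v
  ... | no _    = refl

  toggle-outside : ∀ {v h} (d : Defined (toggle v h)) {w} → w ≢ [ v ] →
                   value (toggle v h) d w ≡ h w
  toggle-outside {h = h} _ = update-≢ _ h

  rowmotion-outside : ∀ vs f (d : Defined (rowmotion vs f)) {x} →
                      (∀ {v} → v ∈ vs → x ≢ [ v ]) → value (rowmotion vs f) d x ≡ f x
  rowmotion-outside []       f d       x∉vs = refl
  rowmotion-outside (v ∷ vs) f (d , t) x∉vs =
    ≡-trans (toggle-outside t (x∉vs (here refl))) (rowmotion-outside vs f d (x∉vs ∘ there))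

  -- The inverses of the labels of g above w are given by an arbitrary s, and the
  -- equation is cleared of the outer inverse, so that it depends on no
  -- definedness proof but that of f(w)⁻¹.
  RowmotionEquation : Labeling → Labeling → Carrier → Set _
  RowmotionEquation f g w =
    Σ[ y ∈ Invertible 1# _*_ (f [ w ]) ]
      ∀ (s : P̂ → 𝕂) → (∀ {u} → [ w ] ⋖ u → s u InverseOf g u) →
      g [ w ] * ∑ (upperCovers [ w ]) s ≈ ∑ (lowerCovers [ w ]) f * proj₁ y

  -- The equation at `w` reads `g` only at `w` and its upper covers, so it survives toggles
  -- elsewhere.
  equation-resp : ∀ {f g g′ w} → g′ [ w ] ≡ g [ w ] → (∀ {u} → [ w ] ⋖ u → g′ u ≡ g u) →
                  RowmotionEquation f g w → RowmotionEquation f g′ w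
  equation-resp {f} {g} {g′} {w} g′w≡gw g′≡g (y , eq) =
    y , λ s inv → ≈-trans (*-congʳ (reflexive g′w≡gw))
                    (eq s λ w⋖u → inverse-resp (reflexive (g′≡g w⋖u)) (inv w⋖u))

  -- Here `h` is the labeling just before the toggle at `v`. Multiplying the toggle formula on the
  -- right by the sum of the inverses above `v` cancels `z`; the toggle leaves the labels above `v`
  -- unchanged.
  toggle-equation : ∀ {v f h} (d : Defined (toggle v h)) →
                    h [ v ] ≡ f [ v ] → (∀ {u} → u ⋖ [ v ] → h u ≡ f u) →
                    RowmotionEquation f (value (toggle v h) d) v
  toggle-equation {v} {f} {h} ((y , y-inv) , S , (z , zS , _) , _) hv≡fv h≡f =
    (y , inverse-resp (reflexive hv≡fv) y-inv) , λ s s-inv → begin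
      g [ v ] * ∑ (upperCovers [ v ]) s
        ≈⟨ *-cong (reflexive (update-≡ [ v ] new h))
                  (≈-sym (∑ᵖ-value (upperCovers [ v ]) (λ u → h u ⁻¹) (λ u∈ (_ , inv) →
                    let v⋖u = proj₂ (∈-filter⁻ ([ v ] ⋖?_) {xs = elements±} u∈) in
                    inverse-unique inv (inverse-resp (reflexive (g≡h v⋖u)) (s-inv v⋖u))) S)) ⟩
      L * y * z * value (∑ᵖ (upperCovers [ v ]) (λ u → h u ⁻¹)) S
        ≈⟨ cancelʳ zS _ ⟩
      L * y
        ≈⟨ *-congʳ (∑-cong (lowerCovers [ v ]) λ u∈ →
             reflexive (h≡f (proj₂ (∈-filter⁻ (_⋖? [ v ]) {xs = elements±} u∈)))) ⟩
      ∑ (lowerCovers [ v ]) f * y ∎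
    where
    L   = ∑ (lowerCovers [ v ]) h
    new = L * y * z
    g   = update [ v ] new h
    g≡h : ∀ {u} → [ v ] ⋖ u → g u ≡ h u
    g≡h ((_ , v≢u) , _) = update-≢ new h λ { refl → v≢u refl }

  -- Induction on the list, whose head is the toggle that acts last.
  rowmotion-equation : ∀ {vs} → AllPairs (λ v w → ¬ w ≤ v) vs →
                       ∀ f (d : Defined (rowmotion vs f)) {w} → w ∈ vs →
                       RowmotionEquation f (value (rowmotion vs f) d) w
  -- No element toggled before `v` is `≤ v`, so `v` and its lower covers still carry their labels
  -- from `f`.
  rowmotion-equation {v ∷ vs} (vs≰v ∷ _) f (d , t) (here refl) =
    toggle-equation t
      (rowmotion-outside vs f d λ { v∈vs refl → All.lookup vs≰v v∈vs ≤-refl })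
      (λ u⋖v → rowmotion-outside vs f d λ { w∈vs refl → All.lookup vs≰v w∈vs (⋖⇒≤ u⋖v) })
  -- Since `w ≤ v` fails, `v` is neither `w` nor an upper cover of `w`, so the last toggle preserves
  -- the equation.
  rowmotion-equation {v ∷ vs} (vs≰v ∷ ordered) f (d , t) (there w∈vs) =
    equation-resp
      (toggle-outside t λ { refl → All.lookup vs≰v w∈vs ≤-refl })
      (λ w⋖u → toggle-outside t λ { refl → All.lookup vs≰v w∈vs (⋖⇒≤ w⋖u) })
      (rowmotion-equation ordered f d w∈vs)

  -- Splitting sums over covers at 0 and 1.

  ∑-elements± : (F : P̂ → 𝕂) → ∑ elements± F ≈ F ⊥± + (F ⊤± + ∑ elements (F ∘ [_]))
  ∑-elements± F = +-congˡ (+-congˡ (reflexive (∑-map [_] elements F)))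

  -- The row of 1 is empty, since 1 has no upper covers.
  ∑-upper : (F : P̂ → P̂ → 𝕂) →
    ∑ elements± (λ u → ∑ (upperCovers u) (F u)) ≈
    ∑ (upperCovers ⊥±) (F ⊥±) + ∑ elements (λ u → ∑ (upperCovers [ u ]) (F [ u ]))
  ∑-upper F = begin
    ∑ elements± (λ u → ∑ (upperCovers u) (F u))
      ≈⟨ ∑-elements± _ ⟩
    _ + (∑ (upperCovers ⊤±) (F ⊤±) + _)
      ≈⟨ +-congˡ (+-congʳ (reflexive (cong (λ xs → ∑ xs (F ⊤±)) upperCovers-⊤±))) ⟩
    _ + (0# + _)
      ≈⟨ +-congˡ (+-identityˡ _) ⟩
    _ ∎

  -- Dually, 0 has no lower covers.
  ∑-lower : (F : P̂ → P̂ → 𝕂) →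
    ∑ elements± (λ v → ∑ (lowerCovers v) (λ u → F u v)) ≈
    ∑ (lowerCovers ⊤±) (λ u → F u ⊤±) +
    ∑ elements (λ v → ∑ (lowerCovers [ v ]) (λ u → F u [ v ]))
  ∑-lower F = begin
    ∑ elements± (λ v → ∑ (lowerCovers v) (λ u → F u v))
      ≈⟨ ∑-elements± _ ⟩
    ∑ (lowerCovers ⊥±) (λ u → F u ⊥±) + _
      ≈⟨ +-congʳ (reflexive (cong (λ xs → ∑ xs (λ u → F u ⊥±)) lowerCovers-⊥±)) ⟩
    0# + _
      ≈⟨ +-identityˡ _ ⟩
    _ ∎

  coverSum-value : ∀ f (inv : ∀ v → Invertible 1# _*_ (f v)) (d : Defined (coverSum f)) →
                   value (coverSum f) d ≈ ∑ coverPairs (uncurry λ u v → f u * proj₁ (inv v))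
  coverSum-value f inv =
    ∑ᵖ-value coverPairs _ λ { {u , v} _ ((_ , y-inv) , _) →
      *-congˡ (inverse-unique y-inv (proj₂ (inv v))) }

  -- Some `u` is covered by `v`, so the pair `(u , v)` contributes a term containing the inverse of
  -- `f v`.
  covered-invertible : ∀ f → Defined (coverSum f) → ∀ {v} → v ≢ ⊥± → Invertible 1# _*_ (f v)
  covered-invertible f d {v} v≢⊥± with lower-cover v≢⊥±
  ... | u , u⋖v = proj₁ (∑ᵖ-defined⁻ d
    (∈-filter⁺ (uncurry _⋖?_) (∈-cartesianProduct⁺ (complete± u) (complete± v)) u⋖v))

  -- Equality of cover sums for two labelings linked by the equation.

  module _ (f g f⁻¹ g⁻¹ : Labeling)
           (f-inv : ∀ v → f⁻¹ v InverseOf f v) (g-inv : ∀ v → g⁻¹ v InverseOf g v)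
           (equation : ∀ v → g [ v ] * ∑ (upperCovers [ v ]) g⁻¹ ≈
                             ∑ (lowerCovers [ v ]) f * f⁻¹ [ v ]) where

    boundary : ∑ (upperCovers ⊥±) g⁻¹ * f ⊥± ≈ g⁻¹ ⊤± * ∑ (lowerCovers ⊤±) f
    boundary = begin
      ∑ (upperCovers ⊥±) g⁻¹ * f ⊥±
        ≈⟨ *-distribʳ-∑ _ (upperCovers ⊥±) g⁻¹ ⟩
      ∑ (upperCovers ⊥±) (F ⊥±)
        -- The sum of `g⁻¹ v * f u` over all covers is grouped by `u` and then by `v`; `balance`
        -- shows that both groupings have the same part over P, which cancels.
        ≈⟨ ∙-cancelʳ inner _ _ (begin
             ∑ (upperCovers ⊥±) (F ⊥±) + inner
               ≈⟨ ∑-upper F ⟨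
             ∑ elements± (λ u → ∑ (upperCovers u) (F u))
               ≈⟨ ∑-filter-swap _⋖?_ elements± elements± F ⟩
             ∑ elements± (λ v → ∑ (lowerCovers v) (λ u → F u v))
               ≈⟨ ∑-lower F ⟩
             ∑ (lowerCovers ⊤±) (λ u → F u ⊤±) +
             ∑ elements (λ v → ∑ (lowerCovers [ v ]) (λ u → F u [ v ]))
               ≈⟨ +-congˡ (∑-cong elements λ {v} _ → balance v) ⟩
             ∑ (lowerCovers ⊤±) (λ u → F u ⊤±) + inner ∎) ⟩
      ∑ (lowerCovers ⊤±) (λ u → F u ⊤±)
        ≈⟨ *-distribˡ-∑ _ (lowerCovers ⊤±) f ⟨
      g⁻¹ ⊤± * ∑ (lowerCovers ⊤±) f ∎
      where
      F : P̂ → P̂ → 𝕂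
      F u v = g⁻¹ v * f u
      inner = ∑ elements (λ u → ∑ (upperCovers [ u ]) (F [ u ]))
      balance : ∀ v → ∑ (lowerCovers [ v ]) (λ u → F u [ v ]) ≈ ∑ (upperCovers [ v ]) (F [ v ])
      balance v = begin
        ∑ (lowerCovers [ v ]) (λ u → F u [ v ])
          ≈⟨ *-distribˡ-∑ _ (lowerCovers [ v ]) f ⟨
        g⁻¹ [ v ] * L
          -- Inserting `f⁻¹ [ v ] * f [ v ]` produces the right-hand side of `equation`.
          ≈⟨ *-congˡ (cancelʳ (proj₁ (f-inv [ v ])) L) ⟨
        g⁻¹ [ v ] * (L * f⁻¹ [ v ] * f [ v ])
          ≈⟨ *-congˡ (*-congʳ (equation v)) ⟨
        g⁻¹ [ v ] * (g [ v ] * U * f [ v ])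
          ≈⟨ *-congˡ (*-assoc _ _ _) ⟩
        g⁻¹ [ v ] * (g [ v ] * (U * f [ v ]))
          ≈⟨ cancelˡ (proj₁ (g-inv [ v ])) _ ⟩
        U * f [ v ]
          ≈⟨ *-distribʳ-∑ _ (upperCovers [ v ]) g⁻¹ ⟩
        ∑ (upperCovers [ v ]) (F [ v ]) ∎
        where
        L = ∑ (lowerCovers [ v ]) f
        U = ∑ (upperCovers [ v ]) g⁻¹

    coverSums-agree : f ⊥± ≈ 1# → g ⊥± ≈ 1# → f ⊤± ≈ 1# → g ⊤± ≈ 1# →
      ∑ coverPairs (uncurry λ u v → g u * g⁻¹ v) ≈ ∑ coverPairs (uncurry λ u v → f u * f⁻¹ v)
    coverSums-agree f0≈1 g0≈1 f1≈1 g1≈1 = begin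
      ∑ coverPairs (uncurry λ u v → g u * g⁻¹ v)
        ≈⟨ ∑-filter-cartesianProduct _⋖?_ elements± elements± _ ⟩
      ∑ elements± (λ u → ∑ (upperCovers u) (λ v → g u * g⁻¹ v))
        ≈⟨ ∑-upper _ ⟩
      ∑ (upperCovers ⊥±) (λ v → g ⊥± * g⁻¹ v) +
      ∑ elements (λ u → ∑ (upperCovers [ u ]) (λ v → g [ u ] * g⁻¹ v))
        -- With the left sum grouped by lower elements and the right by upper ones, the terms at `w`
        -- in P are the two sides of `equation w`.
        ≈⟨ +-cong outer (∑-cong elements λ {w} _ → begin
             ∑ (upperCovers [ w ]) (λ v → g [ w ] * g⁻¹ v)
               ≈⟨ *-distribˡ-∑ _ (upperCovers [ w ]) g⁻¹ ⟨
             g [ w ] * ∑ (upperCovers [ w ]) g⁻¹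
               ≈⟨ equation w ⟩
             ∑ (lowerCovers [ w ]) f * f⁻¹ [ w ]
               ≈⟨ *-distribʳ-∑ _ (lowerCovers [ w ]) f ⟩
             ∑ (lowerCovers [ w ]) (λ u → f u * f⁻¹ [ w ]) ∎) ⟩
      ∑ (lowerCovers ⊤±) (λ u → f u * f⁻¹ ⊤±) +
      ∑ elements (λ v → ∑ (lowerCovers [ v ]) (λ u → f u * f⁻¹ [ v ]))
        ≈⟨ ∑-lower _ ⟨
      ∑ elements± (λ v → ∑ (lowerCovers v) (λ u → f u * f⁻¹ v))
        ≈⟨ ∑-filter-swap _⋖?_ elements± elements± _ ⟨
      ∑ elements± (λ u → ∑ (upperCovers u) (λ v → f u * f⁻¹ v))
        ≈⟨ ∑-filter-cartesianProduct _⋖?_ elements± elements± _ ⟨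
      ∑ coverPairs (uncurry λ u v → f u * f⁻¹ v) ∎
      where
      ⁻¹≈1 : ∀ {x y} → y InverseOf x → x ≈ 1# → y ≈ 1#
      ⁻¹≈1 y-inv x≈1 = inverse-unique y-inv (≈1#⇒inverse x≈1)
      -- The sums here carry the factors `g ⊥±` and `f⁻¹ ⊤±`, those in `boundary` carry `f ⊥±` and
      -- `g⁻¹ ⊤±`, on opposite sides; all four equal 1 by the normalization.
      outer : ∑ (upperCovers ⊥±) (λ v → g ⊥± * g⁻¹ v) ≈ ∑ (lowerCovers ⊤±) (λ u → f u * f⁻¹ ⊤±)
      outer = begin
        ∑ (upperCovers ⊥±) (λ v → g ⊥± * g⁻¹ v) ≈⟨ *-distribˡ-∑ _ (upperCovers ⊥±) g⁻¹ ⟨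
        g ⊥± * ∑ (upperCovers ⊥±) g⁻¹           ≈⟨ *-congʳ g0≈1 ⟩
        1# * ∑ (upperCovers ⊥±) g⁻¹             ≈⟨ *-identityˡ _ ⟩
        ∑ (upperCovers ⊥±) g⁻¹                  ≈⟨ *-identityʳ _ ⟨
        ∑ (upperCovers ⊥±) g⁻¹ * 1#             ≈⟨ *-congˡ f0≈1 ⟨
        ∑ (upperCovers ⊥±) g⁻¹ * f ⊥±           ≈⟨ boundary ⟩
        g⁻¹ ⊤± * ∑ (lowerCovers ⊤±) f           ≈⟨ *-congʳ (⁻¹≈1 (g-inv ⊤±) g1≈1) ⟩
        1# * ∑ (lowerCovers ⊤±) f               ≈⟨ *-identityˡ _ ⟩
        ∑ (lowerCovers ⊤±) f                    ≈⟨ *-identityʳ _ ⟨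
        ∑ (lowerCovers ⊤±) f * 1#               ≈⟨ *-congˡ (⁻¹≈1 (f-inv ⊤±) f1≈1) ⟨
        ∑ (lowerCovers ⊤±) f * f⁻¹ ⊤±           ≈⟨ *-distribʳ-∑ _ (lowerCovers ⊤±) f ⟩
        ∑ (lowerCovers ⊤±) (λ u → f u * f⁻¹ ⊤±) ∎

proposition14p2 :
    ∀ {c ℓ p ℓ′} (K : Ring c ℓ) (P : FinitePoset p ℓ′) →
    let open Ring K using (_≈_)
        open Ring K using (1#)
        open Rowmotion K P in
    ∀ (vs : List (FinitePoset.Carrier P)) → FinitePoset.IsLinearExtension P vs →
    ∀ (f : Labeling) (Rf≢⊥ : Defined (rowmotion vs f)) →
    f ⊥± ≈ 1# → f ⊤± ≈ 1# →
    let Rf = value (rowmotion vs f) Rf≢⊥ in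
    ∀ (lhs : Defined (coverSum Rf)) →
    Σ[ rhs ∈ Defined (coverSum f) ] value (coverSum Rf) lhs ≈ value (coverSum f) rhs
proposition14p2 K P vs ext f Rf≢⊥ f0≈1 f1≈1 lhs = rhs , (begin
    value (coverSum g) lhs
      ≈⟨ coverSum-value g g-invertible lhs ⟩
    ∑ coverPairs (uncurry λ u v → g u * proj₁ (g-invertible v))
      ≈⟨ coverSums-agree f g (proj₁ ∘ f-invertible) (proj₁ ∘ g-invertible)
           (proj₂ ∘ f-invertible) (proj₂ ∘ g-invertible)
           (λ v → proj₂ (equation v) _ (λ {u} _ → proj₂ (g-invertible u)))
           f0≈1 g0≈1 f1≈1 g1≈1 ⟩
    ∑ coverPairs (uncurry λ u v → f u * proj₁ (f-invertible v))
      ≈⟨ coverSum-value f f-invertible rhs ⟨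
    value (coverSum f) rhs ∎)
  where
  open Ring K using (_≈_; _*_; 1#; setoid; reflexive) renaming (trans to ≈-trans)
  open Algebra.Definitions _≈_ using (Invertible)
  open Relation.Binary.Reasoning.Setoid setoid
  open FinitePoset P using (coverPairs; IsLinearExtension)
  open Rowmotion K P
  open Covers P
  open Sums K P
  open RowmotionProperties K P

  g : Labeling
  g = value (rowmotion vs f) Rf≢⊥

  equation : ∀ v → RowmotionEquation f g v
  equation v = rowmotion-equation (linearExtension-≰ ext) f Rf≢⊥
                 (IsLinearExtension.allElements ext v)

  g0≈1 : g ⊥± ≈ 1#
  g0≈1 = ≈-trans (reflexive (rowmotion-outside vs f Rf≢⊥ λ _ ())) f0≈1

  g1≈1 : g ⊤± ≈ 1#
  g1≈1 = ≈-trans (reflexive (rowmotion-outside vs f Rf≢⊥ λ _ ())) f1≈1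

  f-invertible : ∀ v → Invertible 1# _*_ (f v)
  f-invertible ⊥±    = 1# , ≈1#⇒inverse f0≈1
  f-invertible ⊤±    = 1# , ≈1#⇒inverse f1≈1
  -- The toggle at `v` inverts the label of `f` there, so definedness of rowmotion supplies this
  -- inverse.
  f-invertible [ v ] = proj₁ (equation v)

  g-invertible : ∀ v → Invertible 1# _*_ (g v)
  -- No cover has 0 on top, so `lhs` says nothing about the label at 0; its inverse comes from the
  -- normalization.
  g-invertible ⊥±    = 1# , ≈1#⇒inverse g0≈1
  g-invertible ⊤±    = covered-invertible g lhs λ ()
  g-invertible [ v ] = covered-invertible g lhs λ ()

  rhs : Defined (coverSum f)
  rhs = ∑ᵖ-defined {xs = coverPairs} λ { {_ , v} _ → f-invertible v , _ }
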